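{- Let $\mathbb K=(K,\oplus,\otimes,\mathbf 0,\mathbf 1)$ be a commutative semiring, $\mathcal O^{\mathbb K}$ a $\mathbb K$-annotated $\mathcal{ELHI}^n_\bot$ ontology, $\alpha$ an axiom, and $\kappa\in K$. Let $\mathsf{NF}(\mathcal O^{\mathbb K})$ be obtained by applying exhaustively the rules $\mathsf{NF}_1$–$\mathsf{NF}_4$ to $\mathcal O^{\mathbb K}$, where (for $\widehat C,\widehat D\notin\mathsf{N_C}\cup\{\top\}$, and with a fresh concept name $A$, not appearing so far in the ontology, at each transformation step) the rule replaces the annotated axiom on the left by those on the right: - $\mathsf{NF}_1$: $(C\sqcap\widehat D\sqsubseteq E,\kappa_0)\longrightarrow(\widehat D\sqsubseteq A,\mathbf 1),\ (C\sqcap A\sqsubseteq E,\kappa_0)$; - $\mathsf{NF}_2$: $(\widehat C\sqcap D\sqsubseteq E,\kappa_0)\longrightarrow(\widehat C\sqsubseteq A,\mathbf 1),\ (A\sqcap D\sqsubseteq E,\kappa_0)$; - $\mathsf{NF}_3$: $(\exists P.\widehat C\sqsubseteq D,\kappa_0)\longrightarrow(\widehat C\sqsubseteq A,\mathbf 1),\ (\exists P.A\sqsubseteq D,\kappa_0)$; - $\mathsf{NF}_4$: $(\widehat C\sqsubseteq\exists P,\kappa_0)\longrightarrow(\widehat C\sqsubseteq A,\mathbf 1),\ (A\sqsubseteq\exists P,\kappa_0)$. Then: - If $\mathcal O^{\mathbb K}\models(\alpha,\kappa)$, then $\mathsf{NF}(\mathcal O^{\mathbb K})\models(\alpha,\kappa)$.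 - If $\mathsf{NF}(\mathcal O^{\mathbb K})\models(\alpha,\kappa)$ and every concept name occurring in $\alpha$ also occurs in $\mathcal O^{\mathbb K}$, then $\mathcal O^{\mathbb K}\models(\alpha,\kappa)$.
   Context: Syntax. Let $\mathsf{N_C},\mathsf{N_R},\mathsf{N_I}$ be mutually disjoint countable sets of concept, role and individual names. A role $P$ is a role name $R\in\mathsf{N_R}$ or an inverse role $R^-$. Concepts: $C::=A\mid\exists P.C\mid C\sqcap C\mid\top$ ($A\in\mathsf{N_C}$); $\exists P$ abbreviates $\exists P.\top$. $\mathcal{ELHI}^n_\bot$ axioms: assertions $A(a)$, $R(a,b)$; GCIs $C\sqsubseteq D$ with $C::=A\mid\exists P.C\mid C\sqcap C\mid\top$ and $D::=A\mid\exists P.\top\mid\bot$; role inclusions $P\sqsubseteq Q$ (positive) and $P\sqcap Q\sqsubseteq\bot$ (negative). An ontology is a finite set of axioms. Annotated semantics. A $\mathbb K$-annotated ontology is a pair $\langle\mathcal O,\lambda\rangle$ with $\lambda:\mathcal O\to K\setminus\{\mathbf 0\}$, identified with the set of annotated axioms $(\alpha,\lambda(\alpha))$. A $\mathbb K$-annotated interpretation $\mathcal I$ has a nonempty domain $\Delta^{\mathcal I}$ and maps $a\in\mathsf{N_I}$ to $a^{\mathcal I}\in\Delta^{\mathcal I}$, $A\in\mathsf{N_C}$ to $A^{\mathcal I}\subseteq\Delta^{\mathcal I}\times K$, $R\in\mathsf{N_R}$ to $R^{\mathcal I}\subseteq\Delta^{\mathcal I}\times\Delta^{\mathcal I}\times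 K$, with $\top^{\mathcal I}=\Delta^{\mathcal I}\times\{\mathbf 1\}$, $\bot^{\mathcal I}=\emptyset$, $(R^-)^{\mathcal I}=\{(e,d,\kappa)\mid(d,e,\kappa)\in R^{\mathcal I}\}$, $(\exists P.C)^{\mathcal I}=\{(d,\kappa\otimes\kappa')\mid\exists e:(d,e,\kappa)\in P^{\mathcal I},(e,\kappa')\in C^{\mathcal I}\}$, $(C\sqcap D)^{\mathcal I}=\{(d,\kappa\otimes\kappa')\mid(d,\kappa)\in C^{\mathcal I},(d,\kappa')\in D^{\mathcal I}\}$, $(P\sqcap Q)^{\mathcal I}=\{(d,e,\kappa\otimes\kappa')\mid(d,e,\kappa)\in P^{\mathcal I},(d,e,\kappa')\in Q^{\mathcal I}\}$. $\mathcal I$ satisfies $(C\sqsubseteq D,\kappa)$ if $(d,\kappa')\in C^{\mathcal I}$ implies $(d,\kappa\otimes\kappa')\in D^{\mathcal I}$; $(P\sqsubseteq Q,\kappa)$ if $(d,e,\kappa')\in P^{\mathcal I}$ implies $(d,e,\kappa\otimes\kappa')\in Q^{\mathcal I}$; $(P\sqcap Q\sqsubseteq\bot,\kappa)$ if $(P\sqcap Q)^{\mathcal I}=\emptyset$; $(A(a),\kappa)$ if $(a^{\mathcal I},\kappa)\in A^{\mathcal I}$; $(R(a,b),\kappa)$ if $(a^{\mathcal I},b^{\mathcal I},\kappa)\in R^{\mathcal I}$. Models satisfy all annotated axioms; $\mathcal O^{\mathbb K}\models(\alpha,\kappa)$ if every model of $\mathcal O^{\mathbb K}$ satisfies $(\alpha,\kappa)$.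 -}

module Defs where

open import Level using (Level; Lift; _⊔_) renaming (suc to lsuc)
open import Algebra.Bundles using (CommutativeSemiring)
open import Data.Empty.Polymorphic using (⊥)
open import Data.List.Base using (List; []; _∷_; _++_; [_]; map; concatMap)
open import Data.List.Membership.Propositional using (_∈_; _∉_)
open import Data.List.Relation.Unary.All using (All)
open import Data.List.Relation.Unary.Unique.Propositional using (Unique)
open import Data.Nat.Base using (ℕ)
open import Data.Product.Base using (_×_; _,_; proj₁; proj₂; ∃-syntax)
open import Function.Bundles using (_↔_; _↣_)
open import Relation.Binary.Construct.Closure.ReflexiveTransitive using (Star)
open import Relation.Binary.PropositionalEquality using (_≢_)
open import Relation.Nullary.Negation using (¬_)
open import Relation.Unary using (Pred)
open import Relation.Binary.Definitions using (_Respects_)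

-- The three sets of names are separate types, hence disjoint.  There are
-- infinitely many concept names, so that a fresh one is always available.
record Vocabulary : Set₁ where
  field
    N-C N-R N-I     : Set
    N-C-countable   : N-C ↔ ℕ
    N-R-countable   : N-R ↣ ℕ
    N-I-countable   : N-I ↣ ℕ

module Syntax (V : Vocabulary) where
  open Vocabulary V

  data Role : Set where
    role : N-R → Role
    _⁻   : N-R → Role

  infixr 7 _⊓_

  data Concept : Set where
    name : N-C → Concept
    ∃∙   : Role → Concept → Concept
    _⊓_  : Concept → Concept → Concept
    top  : Concept

  -- Right-hand sides D ::= A ∣ ∃P.⊤ ∣ ⊥ of concept inclusions.
  data RHS : Set where
    name : N-C → RHS
    some : Role → RHS
    bot  : RHS

  infix 5 _⊑_ _⊑ᵣ_

  data Axiom : Set where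
    conceptAssertion : N-C → N-I → Axiom
    roleAssertion    : N-R → N-I → N-I → Axiom
    _⊑_              : Concept → RHS → Axiom
    _⊑ᵣ_             : Role → Role → Axiom
    disjoint         : Role → Role → Axiom   -- P ⊓ Q ⊑ ⊥

  namesᶜ : Concept → List N-C
  namesᶜ (name A) = [ A ]
  namesᶜ (∃∙ P C) = namesᶜ C
  namesᶜ (C ⊓ D)  = namesᶜ C ++ namesᶜ D
  namesᶜ top      = []

  namesʳ : RHS → List N-C
  namesʳ (name A) = [ A ]
  namesʳ (some P) = []
  namesʳ bot      = []

  conceptNames : Axiom → List N-C
  conceptNames (conceptAssertion A a) = [ A ]
  conceptNames (roleAssertion R a b)  = []
  conceptNames (C ⊑ D)                = namesᶜ C ++ namesʳ D
  conceptNames (P ⊑ᵣ Q)               = []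
  conceptNames (disjoint P Q)         = []

  -- Ĉ ∉ N_C ∪ {⊤}
  Complex : Concept → Set
  Complex C = (∀ A → C ≢ name A) × C ≢ top

module Annotated (V : Vocabulary) {c ℓ} (𝕂 : CommutativeSemiring c ℓ) where
  open Vocabulary V
  open Syntax V public
  open CommutativeSemiring 𝕂
    renaming (Carrier to K; _*_ to _⊗_; 0# to 𝟎; 1# to 𝟏)
    using (_≈_)

  AnnotatedAxiom : Set c
  AnnotatedAxiom = Axiom × K

  -- ⟨𝒪, λ⟩ as the graph of λ: no axiom is listed twice, so every axiom carries
  -- exactly one annotation.
  record Ontology : Set (c ⊔ ℓ) where
    field
      axioms  : List AnnotatedAxiom
      unique  : Unique (map proj₁ axioms)
      nonzero : All (λ ακ → ¬ (proj₂ ακ ≈ 𝟎)) axioms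

  names : List AnnotatedAxiom → List N-C
  names = concatMap (λ ακ → conceptNames (proj₁ ακ))

  -- Subsets of Δ × K are predicates closed under the semiring equality _≈_.
  -- They live in a universe large enough to contain the extension of every
  -- concept.
  record Interpretation (d : Level) : Set (lsuc (c ⊔ ℓ ⊔ d)) where
    field
      Δ         : Set d
      inhabited : Δ
      indᴵ      : N-I → Δ
      conᴵ      : N-C → Δ → Pred K (c ⊔ ℓ ⊔ d)
      conᴵ-resp : ∀ A x → conᴵ A x Respects _≈_
      relᴵ      : N-R → Δ → Δ → Pred K (c ⊔ ℓ ⊔ d)
      relᴵ-resp : ∀ R x y → relᴵ R x y Respects _≈_

  module _ {d : Level} (I : Interpretation d) where
    open Interpretation I

    ⟦_⟧ʳ : Role → Δ → Δ → Pred K (c ⊔ ℓ ⊔ d)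
    ⟦ role R ⟧ʳ x y κ = relᴵ R x y κ
    ⟦ R ⁻ ⟧ʳ    x y κ = relᴵ R y x κ

    ⟦_∩_⟧ʳ : Role → Role → Δ → Δ → Pred K (c ⊔ ℓ ⊔ d)
    ⟦ P ∩ Q ⟧ʳ x y μ =
      ∃[ κ ] ∃[ κ′ ] (⟦ P ⟧ʳ x y κ × ⟦ Q ⟧ʳ x y κ′ × μ ≈ (κ ⊗ κ′))

    ⟦_⟧ : Concept → Δ → Pred K (c ⊔ ℓ ⊔ d)
    ⟦ name A ⟧ x μ = conᴵ A x μ
    ⟦ ∃∙ P C ⟧ x μ =
      ∃[ y ] ∃[ κ ] ∃[ κ′ ] (⟦ P ⟧ʳ x y κ × ⟦ C ⟧ y κ′ × μ ≈ (κ ⊗ κ′))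
    ⟦ C ⊓ D ⟧  x μ =
      ∃[ κ ] ∃[ κ′ ] (⟦ C ⟧ x κ × ⟦ D ⟧ x κ′ × μ ≈ (κ ⊗ κ′))
    ⟦ top ⟧    x μ = Lift (c ⊔ ℓ ⊔ d) (μ ≈ 𝟏)

    ⟦_⟧ᴿ : RHS → Δ → Pred K (c ⊔ ℓ ⊔ d)
    ⟦ name A ⟧ᴿ     = ⟦ name A ⟧
    ⟦ some P ⟧ᴿ     = ⟦ ∃∙ P top ⟧
    ⟦ bot ⟧ᴿ    x μ = ⊥

    Satisfies : AnnotatedAxiom → Set (c ⊔ ℓ ⊔ d)
    Satisfies (conceptAssertion A a , κ) = conᴵ A (indᴵ a) κ
    Satisfies (roleAssertion R a b , κ)  = relᴵ R (indᴵ a) (indᴵ b) κ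
    Satisfies (C ⊑ D , κ)        = ∀ x κ′ → ⟦ C ⟧ x κ′ → ⟦ D ⟧ᴿ x (κ ⊗ κ′)
    Satisfies (P ⊑ᵣ Q , κ)       = ∀ x y κ′ → ⟦ P ⟧ʳ x y κ′ → ⟦ Q ⟧ʳ x y (κ ⊗ κ′)
    Satisfies (disjoint P Q , κ) = ∀ x y μ → ¬ ⟦ P ∩ Q ⟧ʳ x y μ

    Model : List AnnotatedAxiom → Set (c ⊔ ℓ ⊔ d)
    Model = All Satisfies

  Entails : (d : Level) → List AnnotatedAxiom → AnnotatedAxiom →
            Set (lsuc (c ⊔ ℓ ⊔ d))
  Entails d O ακ = (I : Interpretation d) → Model I O → Satisfies I ακ

  -- Rule A l r₁ r₂: the axiom l is replaced by r₁ and r₂, which use the new name A.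
  data Rule (A : N-C) : (l r₁ r₂ : AnnotatedAxiom) → Set c where
    NF₁ : ∀ {C D E κ₀} → Complex D →
          Rule A (C ⊓ D ⊑ E , κ₀)    (D ⊑ name A , 𝟏) (C ⊓ name A ⊑ E , κ₀)
    NF₂ : ∀ {C D E κ₀} → Complex C →
          Rule A (C ⊓ D ⊑ E , κ₀)    (C ⊑ name A , 𝟏) (name A ⊓ D ⊑ E , κ₀)
    NF₃ : ∀ {P C D κ₀} → Complex C →
          Rule A (∃∙ P C ⊑ D , κ₀)   (C ⊑ name A , 𝟏) (∃∙ P (name A) ⊑ D , κ₀)
    NF₄ : ∀ {C P κ₀} → Complex C →
          Rule A (C ⊑ some P , κ₀)   (C ⊑ name A , 𝟏) (name A ⊑ some P , κ₀)

  infix 4 _⟶_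

  data _⟶_ : List AnnotatedAxiom → List AnnotatedAxiom → Set c where
    step : ∀ {A l r₁ r₂} xs ys → Rule A l r₁ r₂ →
           A ∉ names (xs ++ l ∷ ys) →
           (xs ++ l ∷ ys) ⟶ (xs ++ r₁ ∷ r₂ ∷ ys)

  -- IsNF O N: N is a result of applying the rules exhaustively to O, for some
  -- order of rule applications and some choice of fresh names.
  IsNF : List AnnotatedAxiom → List AnnotatedAxiom → Set c
  IsNF O N = Star _⟶_ O N × (∀ N′ → ¬ (N ⟶ N′))

{-# OPTIONS --safe #-}
-- A rule only introduces an abbreviation A for a concept C.  A model of the
-- rewritten ontology is already a model of the original one, because
-- (C ⊑ A , 𝟏) transports the annotations of C to A unchanged.  Conversely a model
-- of the original ontology becomes a model of the rewritten one by
-- reinterpreting the fresh name A as the extension of C, which affects no axiom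
-- that does not mention A.
module Submission where

open import Defs
open import Level using (Level; lift; _⊔_)
open import Algebra.Bundles using (CommutativeSemiring)
open import Data.List.Base using (List; []; _∷_; _++_)
open import Data.List.Membership.Propositional using (_∈_; _∉_)
open import Data.List.Membership.Propositional.Properties
  using (∈-++⁺ˡ; ∈-++⁺ʳ; ∈-++⁻; ∈-concatMap⁺; ∈-concatMap⁻)
open import Data.List.Relation.Binary.Subset.Propositional using (_⊆_)
open import Data.List.Relation.Unary.All as All using (All; _∷_)
import Data.List.Relation.Unary.All.Properties as All
open import Data.List.Relation.Unary.Any using (Any; here; there)
import Data.List.Relation.Unary.Any.Properties as Any
open import Data.Nat.Properties using () renaming (_≟_ to _≟ℕ_)
open import Data.Product.Base using (_×_; _,_; proj₁; proj₂)
open import Data.Sum.Base using (_⊎_; inj₁; inj₂; [_,_]′)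
open import Function.Base using (_∘_)
open import Function.Bundles using (_⇔_; mk⇔; Equivalence)
open import Function.Construct.Identity using (⇔-id)
open import Function.Properties.Inverse using (↔⇒↣)
open import Relation.Binary.Construct.Closure.ReflexiveTransitive using (Star; ε; _◅_)
open import Relation.Binary.Definitions using (DecidableEquality; _Respects_)
open import Relation.Binary.PropositionalEquality using (refl)
open import Relation.Nullary.Decidable using (yes; no; via-injection)
open import Relation.Nullary.Negation using (contradiction)
open import Relation.Unary using (Pred)

open Equivalence using (to; from)

module _ (V : Vocabulary) {c ℓ} (𝕂 : CommutativeSemiring c ℓ) where
  open Vocabulary V
  open Annotated V 𝕂
  open CommutativeSemiring 𝕂
    using (_≈_; *-identityˡ)
    renaming (Carrier to K; 1# to 𝟏; sym to ≈-sym; trans to ≈-trans)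

  -- Deciding whether a name is the fresh one allows an interpretation to be altered at that name
  -- alone.
  _≟_ : DecidableEquality N-C
  _≟_ = via-injection (↔⇒↣ N-C-countable) _≟ℕ_

  -- Concept names under rewriting.

  ∉-names⁻ : ∀ {A} O → A ∉ names O → All (λ ακ → A ∉ conceptNames (proj₁ ακ)) O
  ∉-names⁻ O A∉O = All.¬Any⇒All¬ O (A∉O ∘ ∈-concatMap⁺ _)

  -- The abbreviated concept survives as the left-hand side of `r₁`, and the rest of `l` survives in
  -- `r₂`.
  Rule-names : ∀ {A l r₁ r₂ B} → Rule A l r₁ r₂ → B ∈ conceptNames (proj₁ l) →
               B ∈ conceptNames (proj₁ r₁) ⊎ B ∈ conceptNames (proj₁ r₂)
  Rule-names (NF₁ {C} {D} _) B∈ with ∈-++⁻ (namesᶜ C ++ namesᶜ D) B∈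
  ... | inj₂ B∈E = inj₂ (∈-++⁺ʳ _ B∈E)
  ... | inj₁ B∈CD with ∈-++⁻ (namesᶜ C) B∈CD
  ...   | inj₁ B∈C = inj₂ (∈-++⁺ˡ (∈-++⁺ˡ B∈C))
  ...   | inj₂ B∈D = inj₁ (∈-++⁺ˡ B∈D)
  Rule-names (NF₂ {C} {D} _) B∈ with ∈-++⁻ (namesᶜ C ++ namesᶜ D) B∈
  ... | inj₂ B∈E = inj₂ (there (∈-++⁺ʳ _ B∈E))
  ... | inj₁ B∈CD with ∈-++⁻ (namesᶜ C) B∈CD
  ...   | inj₁ B∈C = inj₁ (∈-++⁺ˡ B∈C)
  ...   | inj₂ B∈D = inj₂ (there (∈-++⁺ˡ B∈D))
  Rule-names (NF₃ {C = C} _) B∈ with ∈-++⁻ (namesᶜ C) B∈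
  ... | inj₁ B∈C = inj₁ (∈-++⁺ˡ B∈C)
  ... | inj₂ B∈D = inj₂ (there B∈D)
  Rule-names (NF₄ {C} _) B∈ with ∈-++⁻ (namesᶜ C) B∈
  -- The other case is empty, since `some P` contains no concept name.
  ... | inj₁ B∈C = inj₁ (∈-++⁺ˡ B∈C)

  ⟶-names : ∀ {O O′} → O ⟶ O′ → names O ⊆ names O′
  ⟶-names (step {A} {l} {r₁} {r₂} xs ys r _) {B} =
    ∈-concatMap⁺ _ ∘ [ Any.++⁺ˡ , Any.++⁺ʳ xs ∘ replace ]′ ∘ Any.++⁻ xs ∘ ∈-concatMap⁻ _
    where
    Occurs : AnnotatedAxiom → Set
    Occurs ακ = B ∈ conceptNames (proj₁ ακ)

    replace : Any Occurs (l ∷ ys) → Any Occurs (r₁ ∷ r₂ ∷ ys)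
    replace (here B∈l)   = [ here , there ∘ here ]′ (Rule-names r B∈l)
    replace (there B∈ys) = there (there B∈ys)

  -- From models of the rewritten ontology to models of the original.

  module _ {d : Level} (I : Interpretation d) where
    open Interpretation I

    -- Annotations must be movable along `_≈_` because `𝟏 ⊗ κ` equals `κ` only up to `_≈_`. For
    -- compound concepts the equation stored in the witness absorbs the change, so no recursion
    -- occurs.
    ⟦_⟧-resp : ∀ C x → ⟦ I ⟧ C x Respects _≈_
    ⟦ name A ⟧-resp x κ≈μ = conᴵ-resp A x κ≈μ
    ⟦ ∃∙ P C ⟧-resp x κ≈μ (y , κ₁ , κ₂ , p , q , eq) =
      y , κ₁ , κ₂ , p , q , ≈-trans (≈-sym κ≈μ) eq
    ⟦ C ⊓ D ⟧-resp  x κ≈μ (κ₁ , κ₂ , p , q , eq) =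
      κ₁ , κ₂ , p , q , ≈-trans (≈-sym κ≈μ) eq
    ⟦ top ⟧-resp    x κ≈μ (lift eq) = lift (≈-trans (≈-sym κ≈μ) eq)

    ⊑𝟏⇒⊆ : ∀ C {A} → Satisfies I (C ⊑ name A , 𝟏) → ∀ {x κ} → ⟦ I ⟧ C x κ → conᴵ A x κ
    ⊑𝟏⇒⊆ C {A} C⊑A {x} {κ} p = conᴵ-resp A x (*-identityˡ κ) (C⊑A x κ p)

    -- Concept constructors are monotone: by `r₁`, a witness for the left-hand side of `l` becomes
    -- one for that of `r₂` with the same annotations.
    Rule-sound : ∀ {A l r₁ r₂} → Rule A l r₁ r₂ →
                 Satisfies I r₁ → Satisfies I r₂ → Satisfies I l
    Rule-sound (NF₁ {D = D} _) s₁ s₂ x κ (κ₁ , κ₂ , p , q , eq) =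
      s₂ x κ (κ₁ , κ₂ , p , ⊑𝟏⇒⊆ D s₁ q , eq)
    Rule-sound (NF₂ {C = C} _) s₁ s₂ x κ (κ₁ , κ₂ , p , q , eq) =
      s₂ x κ (κ₁ , κ₂ , ⊑𝟏⇒⊆ C s₁ p , q , eq)
    Rule-sound (NF₃ {C = C} _) s₁ s₂ x κ (y , κ₁ , κ₂ , p , q , eq) =
      s₂ x κ (y , κ₁ , κ₂ , p , ⊑𝟏⇒⊆ C s₁ q , eq)
    Rule-sound (NF₄ {C} _) s₁ s₂ x κ p = s₂ x κ (⊑𝟏⇒⊆ C s₁ p)

    ⟶-sound : ∀ {O O′} → O ⟶ O′ → Model I O′ → Model I O
    ⟶-sound (step xs ys r _) M with All.++⁻ xs M
    ... | Mxs , s₁ ∷ s₂ ∷ Mys = All.++⁺ Mxs (Rule-sound r s₁ s₂ ∷ Mys)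

    ⟶*-sound : ∀ {O N} → Star _⟶_ O N → Model I N → Model I O
    ⟶*-sound ε        M = M
    ⟶*-sound (s ◅ ss) M = ⟶-sound s (⟶*-sound ss M)

  -- Reinterpreting a fresh name.

  module Reinterpret {d : Level} (I : Interpretation d) (A : N-C) (C : Concept) where
    open Interpretation I

    -- `C` is evaluated in the old `I`, so the definition is not circular even if `A` occurs in `C`.
    con′ : N-C → Δ → Pred K (c ⊔ ℓ ⊔ d)
    con′ B with A ≟ B
    ... | yes _ = ⟦ I ⟧ C
    ... | no  _ = conᴵ B

    con′-resp : ∀ B x → con′ B x Respects _≈_
    con′-resp B with A ≟ B
    ... | yes _ = ⟦ I ⟧-resp C
    ... | no  _ = conᴵ-resp B

    I′ : Interpretation d
    I′ = record
      { Δ = Δ ; inhabited = inhabited ; indᴵ = indᴵ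
      ; conᴵ = con′ ; conᴵ-resp = con′-resp
      ; relᴵ = relᴵ ; relᴵ-resp = relᴵ-resp
      }

    con′-new : ∀ {x κ} → con′ A x κ ⇔ ⟦ I ⟧ C x κ
    con′-new with A ≟ A
    ... | yes _   = ⇔-id _
    ... | no  A≢A = contradiction refl A≢A

    con′-old : ∀ B {x κ} → A ∉ B ∷ [] → con′ B x κ ⇔ conᴵ B x κ
    con′-old B A∉B with A ≟ B
    ... | yes A≡B = contradiction (here A≡B) A∉B
    ... | no  _   = ⇔-id _

    ⟦⟧ʳ-same : ∀ P {x y κ} → ⟦ I′ ⟧ʳ P x y κ ⇔ ⟦ I ⟧ʳ P x y κ
    ⟦⟧ʳ-same (role R) = ⇔-id _
    ⟦⟧ʳ-same (R ⁻)    = ⇔-id _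

    -- Allowing different fillers on the two sides covers both an unchanged filler and the
    -- replacement of `C` by `A`.
    ∃∙-cong : ∀ P D E → (∀ {y κ} → ⟦ I′ ⟧ D y κ ⇔ ⟦ I ⟧ E y κ) →
              ∀ {x κ} → ⟦ I′ ⟧ (∃∙ P D) x κ ⇔ ⟦ I ⟧ (∃∙ P E) x κ
    ∃∙-cong P _ _ e = mk⇔
      (λ (y , κ₁ , κ₂ , p , q , eq) → y , κ₁ , κ₂ , to (⟦⟧ʳ-same P) p , to e q , eq)
      (λ (y , κ₁ , κ₂ , p , q , eq) → y , κ₁ , κ₂ , from (⟦⟧ʳ-same P) p , from e q , eq)

    ⊓-cong : ∀ D₁ E₁ D₂ E₂ {x} → (∀ {κ} → ⟦ I′ ⟧ D₁ x κ ⇔ ⟦ I ⟧ E₁ x κ) →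
             (∀ {κ} → ⟦ I′ ⟧ D₂ x κ ⇔ ⟦ I ⟧ E₂ x κ) →
             ∀ {κ} → ⟦ I′ ⟧ (D₁ ⊓ D₂) x κ ⇔ ⟦ I ⟧ (E₁ ⊓ E₂) x κ
    ⊓-cong _ _ _ _ e₁ e₂ = mk⇔
      (λ (κ₁ , κ₂ , p , q , eq) → κ₁ , κ₂ , to e₁ p , to e₂ q , eq)
      (λ (κ₁ , κ₂ , p , q , eq) → κ₁ , κ₂ , from e₁ p , from e₂ q , eq)

    ⟦⟧-same : ∀ D → A ∉ namesᶜ D → ∀ {x κ} → ⟦ I′ ⟧ D x κ ⇔ ⟦ I ⟧ D x κ
    ⟦⟧-same (name B) A∉ = con′-old B A∉
    ⟦⟧-same (∃∙ P D) A∉ = ∃∙-cong P D D (⟦⟧-same D A∉)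
    ⟦⟧-same (D ⊓ E)  A∉ = ⊓-cong D D E E
      (⟦⟧-same D (A∉ ∘ ∈-++⁺ˡ)) (⟦⟧-same E (A∉ ∘ ∈-++⁺ʳ (namesᶜ D)))
    ⟦⟧-same top      A∉ = ⇔-id _

    ⟦⟧ᴿ-same : ∀ D → A ∉ namesʳ D → ∀ {x κ} → ⟦ I′ ⟧ᴿ D x κ ⇔ ⟦ I ⟧ᴿ D x κ
    ⟦⟧ᴿ-same (name B) A∉ = con′-old B A∉
    ⟦⟧ᴿ-same (some P) A∉ = ∃∙-cong P top top (⇔-id _)
    ⟦⟧ᴿ-same bot      A∉ = ⇔-id _

    -- With `D₁` equal to `D₂` this handles inclusions left unchanged; with `A` in `D₁` where `D₂`
    -- has `C`, it compares `r₂` with `l`.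
    Satisfies-⊑ : ∀ D₁ D₂ E {κ} → (∀ {x μ} → ⟦ I′ ⟧ D₁ x μ ⇔ ⟦ I ⟧ D₂ x μ) → A ∉ namesʳ E →
                  Satisfies I′ (D₁ ⊑ E , κ) ⇔ Satisfies I (D₂ ⊑ E , κ)
    Satisfies-⊑ _ _ E e A∉E = mk⇔
      (λ s x κ p → to (⟦⟧ᴿ-same E A∉E) (s x κ (from e p)))
      (λ s x κ p → from (⟦⟧ᴿ-same E A∉E) (s x κ (to e p)))

    Satisfies-same : ∀ α {κ} → A ∉ conceptNames α →
                     Satisfies I′ (α , κ) ⇔ Satisfies I (α , κ)
    Satisfies-same (conceptAssertion B a) A∉ = con′-old B A∉
    Satisfies-same (roleAssertion R a b)  A∉ = ⇔-id _
    Satisfies-same (D ⊑ E)                A∉ =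
      Satisfies-⊑ D D E (⟦⟧-same D (A∉ ∘ ∈-++⁺ˡ)) (A∉ ∘ ∈-++⁺ʳ (namesᶜ D))
    Satisfies-same (P ⊑ᵣ Q)               A∉ = mk⇔
      (λ s x y κ p → to (⟦⟧ʳ-same Q) (s x y κ (from (⟦⟧ʳ-same P) p)))
      (λ s x y κ p → from (⟦⟧ʳ-same Q) (s x y κ (to (⟦⟧ʳ-same P) p)))
    Satisfies-same (disjoint P Q)         A∉ = mk⇔
      (λ s x y μ (κ₁ , κ₂ , p , q , eq) →
        s x y μ (κ₁ , κ₂ , from (⟦⟧ʳ-same P) p , from (⟦⟧ʳ-same Q) q , eq))
      (λ s x y μ (κ₁ , κ₂ , p , q , eq) →
        s x y μ (κ₁ , κ₂ , to (⟦⟧ʳ-same P) p , to (⟦⟧ʳ-same Q) q , eq))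

    new-satisfied : A ∉ namesᶜ C → Satisfies I′ (C ⊑ name A , 𝟏)
    new-satisfied A∉C x κ p =
      -- As `A` does not occur in `C`, the concept `C` has the same extension in `I′` as in `I`,
      -- which is the new extension of `A`.
      from con′-new (⟦ I ⟧-resp C x (≈-sym (*-identityˡ κ)) (to (⟦⟧-same C A∉C) p))

  -- From models of the original ontology to models of the rewritten one.

  abbreviated : ∀ {A l r₁ r₂} → Rule A l r₁ r₂ → Concept
  abbreviated (NF₁ {D = D} _) = D
  abbreviated (NF₂ {C = C} _) = C
  abbreviated (NF₃ {C = C} _) = C
  abbreviated (NF₄ {C = C} _) = C

  module _ {d : Level} (I : Interpretation d) where
    open Reinterpret I

    -- `r₁` holds by the choice of the extension of `A`. `r₂` means in `I′` what `l` means in `I`,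
    -- because `A` stands exactly where the abbreviated concept stood.
    Rule-complete : ∀ {A l r₁ r₂} (r : Rule A l r₁ r₂) → A ∉ conceptNames (proj₁ l) →
                    Satisfies I l →
                    Satisfies (I′ A (abbreviated r)) r₁ × Satisfies (I′ A (abbreviated r)) r₂
    Rule-complete {A} (NF₁ {C} {D} {E} _) A∉ s =
      new-satisfied A D (A∉ ∘ ∈-++⁺ˡ ∘ ∈-++⁺ʳ (namesᶜ C)) ,
      from (Satisfies-⊑ A D (C ⊓ name A) (C ⊓ D) E
             (⊓-cong A D C C (name A) D
               (⟦⟧-same A D C (A∉ ∘ ∈-++⁺ˡ ∘ ∈-++⁺ˡ)) (con′-new A D))
             (A∉ ∘ ∈-++⁺ʳ (namesᶜ (C ⊓ D)))) s
    Rule-complete {A} (NF₂ {C} {D} {E} _) A∉ s =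
      new-satisfied A C (A∉ ∘ ∈-++⁺ˡ ∘ ∈-++⁺ˡ) ,
      from (Satisfies-⊑ A C (name A ⊓ D) (C ⊓ D) E
             (⊓-cong A C (name A) C D D
               (con′-new A C) (⟦⟧-same A C D (A∉ ∘ ∈-++⁺ˡ ∘ ∈-++⁺ʳ (namesᶜ C))))
             (A∉ ∘ ∈-++⁺ʳ (namesᶜ (C ⊓ D)))) s
    Rule-complete {A} (NF₃ {P} {C} {D} _) A∉ s =
      new-satisfied A C (A∉ ∘ ∈-++⁺ˡ) ,
      from (Satisfies-⊑ A C (∃∙ P (name A)) (∃∙ P C) D
             (∃∙-cong A C P (name A) C (con′-new A C))
             (A∉ ∘ ∈-++⁺ʳ (namesᶜ C))) s
    Rule-complete {A} (NF₄ {C} {P} _) A∉ s =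
      new-satisfied A C (A∉ ∘ ∈-++⁺ˡ) ,
      from (Satisfies-⊑ A C (name A) C (some P) (con′-new A C) (A∉ ∘ ∈-++⁺ʳ (namesᶜ C))) s

    step-complete : ∀ {A l r₁ r₂} xs ys (r : Rule A l r₁ r₂) → A ∉ names (xs ++ l ∷ ys) →
                    Model I (xs ++ l ∷ ys) →
                    Model (I′ A (abbreviated r)) (xs ++ r₁ ∷ r₂ ∷ ys)
    step-complete {A} {l} xs ys r A∉ M
      with All.++⁻ xs M | All.++⁻ xs (∉-names⁻ (xs ++ l ∷ ys) A∉)
    ... | Mxs , s ∷ Mys | fxs , A∉l ∷ fys =
      All.++⁺ (transfer fxs Mxs) (proj₁ s₁₂ ∷ proj₂ s₁₂ ∷ transfer fys Mys)
      where
      s₁₂ = Rule-complete r A∉l s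

      transfer : ∀ {zs} → All (λ ακ → A ∉ conceptNames (proj₁ ακ)) zs →
                 Model I zs → Model (I′ A (abbreviated r)) zs
      transfer f m = All.zipWith
        (λ { {α , _} (A∉α , sα) → from (Satisfies-same A (abbreviated r) α A∉α) sα }) (f , m)

  -- The entailment is applied in `I′` and read back in `I`: the names of `α` occur in `O`, so the
  -- fresh `A` is not among them. `I′` keeps the domain of `I`, hence the level `d`.
  ⟶-complete : ∀ {d O O′} α κ → O ⟶ O′ → conceptNames α ⊆ names O →
               Entails d O′ (α , κ) → Entails d O (α , κ)
  ⟶-complete α κ (step {A} xs ys r A∉O) α⊆O O′⊨α I M =
    to (Satisfies-same α (A∉O ∘ α⊆O)) (O′⊨α I′ (step-complete I xs ys r A∉O M))
    where open Reinterpret I A (abbreviated r)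

  ⟶*-complete : ∀ {d O N} α κ → Star _⟶_ O N → conceptNames α ⊆ names O →
                Entails d N (α , κ) → Entails d O (α , κ)
  ⟶*-complete α κ ε        α⊆O N⊨α = N⊨α
  ⟶*-complete α κ (s ◅ ss) α⊆O N⊨α =
    -- Rewriting loses no name, so the condition on `α` passes to the intermediate ontology, as the
    -- induction requires.
    ⟶-complete α κ s α⊆O (⟶*-complete α κ ss (⟶-names s ∘ α⊆O) N⊨α)

theorem4p1 : ∀ {c ℓ} (d : Level) (V : Vocabulary) (𝕂 : CommutativeSemiring c ℓ) →
    let open Annotated V 𝕂 in
    (O : Ontology) (α : Axiom) (κ : CommutativeSemiring.Carrier 𝕂) →
    (N : List AnnotatedAxiom) → IsNF (Ontology.axioms O) N →
    (Entails d (Ontology.axioms O) (α , κ) → Entails d N (α , κ)) ×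
    (Entails d N (α , κ) → conceptNames α ⊆ names (Ontology.axioms O) →
    Entails d (Ontology.axioms O) (α , κ))
theorem4p1 d V 𝕂 O α κ N (O⟶*N , _) =
  (λ O⊨α I M → O⊨α I (⟶*-sound V 𝕂 I O⟶*N M)) ,
  (λ N⊨α α⊆O → ⟶*-complete V 𝕂 α κ O⟶*N α⊆O N⊨α)
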